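{- Let $G$ be a two-connected, cyclically orientable finite simple graph which is neither a cycle nor a single edge. Then there exists an edge $\{v,w\}$ of $G$ such that the graph $G \setminus \{v,w\}$ obtained by deleting the vertices $v$ and $w$ (and all incident edges) is disconnected.
   Context: A cycle in $G$ is a subgraph isomorphic to the graph on $\{1,\dots,n\}$ ($n\ge3$) with edges $\{1,2\},\dots,\{n-1,n\},\{n,1\}$; it is chordless if it is an induced subgraph. An orientation of $G$ assigns to each edge an ordering of its endpoints; its restriction to a cycle is cyclic if the cycle's edges are oriented $(1,2),\dots,(n,1)$ or all oppositely. An orientation of $G$ is cyclic if it is cyclic on every chordless cycle; $G$ is cyclically orientable if it has a cyclic orientation. $G$ is two-connected if it is connected, has at least one edge, and any two edges lie on a common cycle. For $S\subseteq \mathrm{Vert}(G)$, $G\setminus S$ is the subgraph induced on $\mathrm{Vert}(G)\setminus S$. -}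

module Defs where

open import Data.Nat using (ℕ; zero; suc; _≤_)
open import Data.Fin using (Fin; zero; suc)
open import Data.Bool using (Bool; true; false; not)
open import Data.Product using (Σ; ∃; ∃-syntax; _×_; _,_)
open import Data.Sum using (_⊎_)
open import Relation.Nullary using (¬_)
open import Relation.Binary.PropositionalEquality using (_≡_; _≢_)
open import Function.Definitions using (Injective)
open import Function.Bundles using (_⇔_)

record Graph (n : ℕ) : Set where
  field
    adj     : Fin n → Fin n → Bool
    sym     : ∀ u v → adj u v ≡ adj v u
    irrefl  : ∀ u → adj u u ≡ false
open Graph public

Edge : ∀ {n} → Graph n → Fin n → Fin n → Set
Edge G u v = adj G u v ≡ true

-- cyclic successor on Fin (suc m): i ↦ i+1 mod (m+1)
next : ∀ {m} → Fin (suc m) → Fin (suc m)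
next {zero}  zero    = zero
next {suc m} zero    = suc zero
next {suc m} (suc i) with next {m} i
... | zero  = zero
... | suc j = suc (suc j)

CycAdj : ∀ {m} → Fin (suc m) → Fin (suc m) → Set
CycAdj i j = (j ≡ next i) ⊎ (i ≡ next j)

record Cycle {n} (G : Graph n) : Set where
  field
    len   : ℕ            -- the cycle has len + 3 vertices
    vert  : Fin (suc (suc (suc len))) → Fin n
    inj   : Injective _≡_ _≡_ vert
    edges : ∀ i → Edge G (vert i) (vert (next i))
open Cycle public

Chordless : ∀ {n} {G : Graph n} → Cycle G → Set
Chordless {G = G} C = ∀ i j → Edge G (vert C i) (vert C j) → CycAdj i j

OnCycle : ∀ {n} {G : Graph n} → Cycle G → Fin n → Fin n → Set
OnCycle C a b = ∃[ i ] ((vert C i ≡ a × vert C (next i) ≡ b)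
                      ⊎ (vert C i ≡ b × vert C (next i) ≡ a))

-- An orientation: O u v ≡ true means the edge {u,v} is oriented (u,v).
-- Each edge gets exactly one of its two orderings.
record Orientation {n} (G : Graph n) : Set where
  field
    dir    : Fin n → Fin n → Bool
    oneway : ∀ u v → Edge G u v → dir v u ≡ not (dir u v)
open Orientation public

CyclicOn : ∀ {n} {G : Graph n} → Orientation G → Cycle G → Set
CyclicOn O C = (∀ i → dir O (vert C i) (vert C (next i)) ≡ true)
             ⊎ (∀ i → dir O (vert C (next i)) (vert C i) ≡ true)

IsCyclicOrientation : ∀ {n} {G : Graph n} → Orientation G → Set
IsCyclicOrientation {G = G} O = (C : Cycle G) → Chordless C → CyclicOn O C

CyclicallyOrientable : ∀ {n} → Graph n → Set
CyclicallyOrientable G = Σ (Orientation G) IsCyclicOrientation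

data Reach {n} (G : Graph n) (P : Fin n → Set) : Fin n → Fin n → Set where
  here : ∀ {u} → P u → Reach G P u u
  step : ∀ {u x v} → P u → Edge G u x → Reach G P x v → Reach G P u v

ConnectedOn : ∀ {n} → Graph n → (Fin n → Set) → Set
ConnectedOn G P = ∀ u v → P u → P v → Reach G P u v

All : ∀ {n} → Fin n → Set
All _ = Data.Unit.⊤ where import Data.Unit

Connected : ∀ {n} → Graph n → Set
Connected G = ConnectedOn G All

Minus₂ : ∀ {n} → Fin n → Fin n → Fin n → Set
Minus₂ v w x = x ≢ v × x ≢ w

DisconnectedMinus₂ : ∀ {n} → Graph n → Fin n → Fin n → Set
DisconnectedMinus₂ G v w = ¬ ConnectedOn G (Minus₂ v w)

TwoConnected : ∀ {n} → Graph n → Set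
TwoConnected G =
  Connected G
  × (∃[ u ] ∃[ v ] Edge G u v)
  × (∀ a b c d → Edge G a b → Edge G c d →
       Σ (Cycle G) λ C → OnCycle C a b × OnCycle C c d)

IsCycleGraph : ∀ {n} → Graph n → Set
IsCycleGraph {zero} G = Data.Empty.⊥ where import Data.Empty
IsCycleGraph {suc n} G =
  3 ≤ suc n × Σ (Fin (suc n) → Fin (suc n)) λ f →
    Injective _≡_ _≡_ f × (∀ i j → Edge G (f i) (f j) ⇔ CycAdj i j)

IsSingleEdge : ∀ {n} → Graph n → Set
IsSingleEdge {n} G = (n ≡ 2) × ∃[ u ] ∃[ v ] Edge G u v

{-# OPTIONS --safe #-}
module Submission where

-- Call neighbours x, y of a vertex a linked if some walk from x to y avoids a and all
-- neighbours of a except x and y. Shortened to an induced path, it closes up to a chordless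
-- cycle through x, a, y, so a cyclic orientation directs exactly one of the edges ax, ay
-- out of a; hence three neighbours of a are never pairwise linked.
--
-- Suppose no edge separates G and c has three neighbours. Connectedness of G without the
-- ends of an edge gives linked neighbours v, w of c and a further neighbour k off a cycle
-- through v, c, w. If k could not reach both v and w off that cycle, there would be three
-- pairwise linked neighbours of c; and if it can, there are three at v or at w. So all
-- degrees are at most 2 and G is a cycle. Connectivity in a finite graph is decidable,
-- which makes this argument by contradiction constructive.

open import Defs renaming (sym to adj-sym)
open import Data.Nat using (ℕ; zero; suc; s≤s; z≤n)
open import Data.Nat.Properties using (≤-antisym; m≢1+n+m)
open import Data.Fin using (Fin; zero; suc; fromℕ; toℕ; inject₁)
open import Data.Fin.Properties using (_≟_; any?; all?; injective⇒≤)
open import Data.Bool using (Bool; true; false)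
import Data.Bool.Properties as Bool
open import Data.Empty using (⊥; ⊥-elim)
open import Data.Unit using (⊤; tt)
open import Data.List using (List; []; _∷_; filter; allFin)
open import Data.List.Membership.Propositional using (_∈_)
open import Data.List.Membership.Propositional.Properties using (∈-filter⁺; ∈-filter⁻; ∈-allFin)
open import Data.List.Relation.Unary.Any using (here; there)
open import Data.Product using (∃; ∃-syntax; _×_; _,_; proj₁; proj₂; map₂)
open import Data.Sum using (_⊎_; inj₁; inj₂; [_,_]′; swap)
open import Function using (_∘_; _⇔_; mk⇔)
open import Function.Definitions using (Injective)
open import Relation.Nullary using (¬_; Dec; yes; no; ¬?; contradiction)
open import Relation.Nullary.Decidable using (map′; _×-dec_; _⊎-dec_; _→-dec_; decidable-stable)
open import Relation.Unary using (Decidable)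
open import Relation.Binary.PropositionalEquality
  using (_≡_; _≢_; refl; sym; trans; cong; subst; subst₂; ≢-sym)

-- Linear and cyclic successor on finite indices.

-- Successor without wrap-around, suited to recursion along a path; `next` adds only the step from
-- the last index to zero.
data Succ : ∀ {m} → Fin m → Fin m → Set where
  zero : ∀ {m} → Succ {suc (suc m)} zero (suc zero)
  suc  : ∀ {m} {i j : Fin m} → Succ i j → Succ (suc i) (suc j)

toℕ-Succ : ∀ {m} {i j : Fin m} → Succ i j → toℕ j ≡ suc (toℕ i)
toℕ-Succ zero    = refl
toℕ-Succ (suc s) = cong suc (toℕ-Succ s)

Succ⇒next : ∀ {m} {i j : Fin (suc m)} → Succ i j → next i ≡ j
Succ⇒next {suc m} zero = refl
Succ⇒next {suc m} (suc {i = i} s) with next i | Succ⇒next s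
Succ⇒next {suc (suc m)} (suc zero)    | _ | refl = refl
Succ⇒next {suc (suc m)} (suc (suc s)) | _ | refl = refl

next-last : ∀ m → next (fromℕ m) ≡ zero
next-last zero = refl
next-last (suc m) with next (fromℕ m) | next-last m
... | _ | refl = refl

next-view : ∀ {m} (i : Fin (suc m)) → Succ i (next i) ⊎ i ≡ fromℕ m
next-view {zero}  zero = inj₂ refl
next-view {suc m} zero = inj₁ zero
next-view {suc m} (suc i) with next-view i
... | inj₁ s    = inj₁ (subst (Succ (suc i)) (sym (Succ⇒next (suc s))) (suc s))
... | inj₂ refl = inj₂ refl

Succ-inject₁ : ∀ {m} (i : Fin m) → Succ (inject₁ i) (suc i)
Succ-inject₁ zero    = zero
Succ-inject₁ (suc i) = suc (Succ-inject₁ i)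

next-surjective : ∀ {m} (i : Fin (suc m)) → ∃[ j ] next j ≡ i
next-surjective {m} zero    = fromℕ m , next-last m
next-surjective     (suc i) = inject₁ i , Succ⇒next (Succ-inject₁ i)

-- Each step raises `toℕ` by one or wraps to zero, so two steps can return only when there are at
-- most two indices. Hence the two cycle neighbours of a cycle vertex differ.
next²≢id : ∀ {m} (i : Fin (suc (suc (suc m)))) → next (next i) ≢ i
next²≢id {m} i eq with next-view i
... | inj₂ refl rewrite next-last (suc (suc m)) = contradiction eq λ ()
... | inj₁ s with next-view (next i)
...   | inj₁ t = m≢1+n+m (toℕ i)
        (trans (cong toℕ (sym eq)) (trans (toℕ-Succ t) (cong suc (toℕ-Succ s))))
...   | inj₂ last = impossible (trans (sym eq) (trans (cong next last) (next-last _)))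
                               (subst (Succ i) last s)
  where
  impossible : ∀ {i} → i ≡ zero → ¬ Succ i (fromℕ (suc (suc m)))
  impossible refl ()

no-three-Bools : ∀ {a b c : Bool} → a ≢ b → b ≢ c → a ≢ c → ⊥
no-three-Bools {false} {false} a≢b _   _   = a≢b refl
no-three-Bools {false} {true} {false} _ _ a≢c = a≢c refl
no-three-Bools {false} {true} {true}  _ b≢c _ = b≢c refl
no-three-Bools {true} {true} a≢b _   _   = a≢b refl
no-three-Bools {true} {false} {true}  _ _ a≢c = a≢c refl
no-three-Bools {true} {false} {false} _ b≢c _ = b≢c refl

-- Walks inside a vertex set, and decidability of connectivity.

module _ {n} {G : Graph n} where

  edge? : ∀ u v → Dec (Edge G u v)
  edge? u v = adj G u v Bool.≟ true

  edge-sym : ∀ {u v} → Edge G u v → Edge G v u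
  edge-sym {u} {v} e = trans (adj-sym G v u) e

  edge⇒≢ : ∀ {u v} → Edge G u v → u ≢ v
  edge⇒≢ {u} e refl with trans (sym e) (irrefl G u)
  ... | ()

  private variable
    P Q : Fin n → Set
    u v x : Fin n

  reach-map : (∀ {z} → P z → Q z) → Reach G P u v → Reach G Q u v
  reach-map f (here p)     = here (f p)
  reach-map f (step p e r) = step (f p) e (reach-map f r)

  reach-head : Reach G P u v → P u
  reach-head (here p)     = p
  reach-head (step p _ _) = p

  reach-last : Reach G P u v → P v
  reach-last (here p)     = p
  reach-last (step _ _ r) = reach-last r

  reach-snoc : Reach G P u v → Edge G v x → P x → Reach G P u x
  reach-snoc (here p)     e px = step p e (here px)
  reach-snoc (step p d r) e px = step p d (reach-snoc r e px)

  reach-sym : Reach G P u v → Reach G P v u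
  reach-sym (here p)     = here p
  reach-sym (step p e r) = reach-snoc (reach-sym r) (edge-sym e) p

  reach-trans : Reach G P u v → Reach G P v x → Reach G P u x
  reach-trans (here _)     s = s
  reach-trans (step p e r) s = step p e (reach-trans r s)

  first-hit : Decidable Q → Reach G P u v → ¬ Q u → Q v →
    ∃[ y ] ∃[ z ] (Reach G (λ t → P t × ¬ Q t) u y × Edge G y z × P z × Q z)
  first-hit Q? (here _) ¬qu qv = contradiction qv ¬qu
  first-hit Q? (step {x = x} p e r) ¬qu qv with Q? x
  ... | yes qx = _ , x , here (p , ¬qu) , e , reach-head r , qx
  ... | no ¬qx = let y , z , s , rest = first-hit Q? r ¬qx qv
                 in  y , z , step (p , ¬qu) e s , rest

  -- Cutting at the first vertex in `Q` leaves no other such vertex on the walk. With `Q` the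
  -- neighbourhood of a vertex, this supplies the uniqueness condition of `Spoke`.
  reach-first : Decidable Q → Reach G P u v → Q v →
    ∃[ z ] (Q z × Reach G (λ t → P t × (Q t → t ≡ z)) u z)
  reach-first {u = u} Q? r qv with Q? u
  ... | yes qu = u , qu , here (reach-head r , λ _ → refl)
  ... | no ¬qu = let _ , z , s , e , pz , qz = first-hit Q? r ¬qu qv
                 in  z , qz , reach-snoc (reach-map (map₂ λ ¬q q → contradiction q ¬q) s)
                                         e (pz , λ _ → refl)

  -- The walks through x ∷ xs either avoid x or split at their first and last visit to x.
  private
    reach∈? : ∀ xs u v → Dec (Reach G (_∈ xs) u v)
    reach∈? []       u v = no λ r → case-[] (reach-head r)
      where case-[] : ¬ (u ∈ [])
            case-[] ()
    reach∈? (x ∷ xs) u v = map′ join split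
        (reach∈? xs u v ⊎-dec (reaches? u ×-dec reaches? v))
      where
      Reaches : Fin n → Set
      Reaches u = u ≡ x ⊎ ∃[ y ] (Reach G (_∈ xs) u y × Edge G y x)

      reaches? : Decidable Reaches
      reaches? u = (u ≟ x) ⊎-dec any? λ y → reach∈? xs u y ×-dec edge? y x

      to : ∀ {u} → Reaches u → Reach G (_∈ (x ∷ xs)) u x
      to (inj₁ refl)        = here (here refl)
      to (inj₂ (_ , r , e)) = reach-snoc (reach-map there r) e (here refl)

      join : ∀ {u v} → Reach G (_∈ xs) u v ⊎ (Reaches u × Reaches v) →
             Reach G (_∈ (x ∷ xs)) u v
      join (inj₁ r)       = reach-map there r
      join (inj₂ (r , s)) = reach-trans (to r) (reach-sym (to s))

      split : ∀ {u v} → Reach G (_∈ (x ∷ xs)) u v →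
              Reach G (_∈ xs) u v ⊎ (Reaches u × Reaches v)
      split (here (here u≡x))  = inj₂ (inj₁ u≡x , inj₁ u≡x)
      split (here (there u∈))  = inj₁ (here u∈)
      split (step p e r) with p | split r
      ... | here refl | inj₁ s = inj₂ (inj₁ refl , inj₂ (_ , reach-sym s , edge-sym e))
      ... | here refl | inj₂ (_ , t) = inj₂ (inj₁ refl , t)
      ... | there u∈ | inj₁ s = inj₁ (step u∈ e s)
      ... | there u∈ | inj₂ (inj₁ refl , t) = inj₂ (inj₂ (_ , here u∈ , e) , t)
      ... | there u∈ | inj₂ (inj₂ (y , s , d) , t) = inj₂ (inj₂ (y , step u∈ e s , d) , t)

  reach? : Decidable P → ∀ u v → Dec (Reach G P u v)
  reach? P? u v =
    map′ (reach-map λ z∈ → proj₂ (∈-filter⁻ P? {xs = allFin n} z∈))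
         (reach-map λ {z} → ∈-filter⁺ P? (∈-allFin z))
         (reach∈? (filter P? (allFin n)) u v)

  connectedOn? : Decidable P → Dec (ConnectedOn G P)
  connectedOn? P? = all? λ u → all? λ v → P? u →-dec (P? v →-dec reach? P? u v)

  -- Induced paths.

  -- Defined mutually with `at`, so that `cons` can forbid repetitions and chords at the new first
  -- vertex. The numeric index counts edges.
  data InducedPath (P : Fin n → Set) : Fin n → Fin n → ℕ → Set

  at : ∀ {m} → InducedPath P u v m → Fin (suc m) → Fin n

  data InducedPath P where
    nil  : ∀ {u} → P u → InducedPath P u u zero
    cons : ∀ {u x v m} → P u → Edge G u x → (π : InducedPath P x v m) →
           (∀ i → at π i ≢ u) → (∀ i → Edge G u (at π i) → i ≡ zero) →
           InducedPath P u v (suc m)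

  at {u = u} (nil _)            _       = u
  at {u = u} (cons _ _ _ _ _)   zero    = u
  at         (cons _ _ π _ _)   (suc i) = at π i

  at-zero : ∀ {m} (π : InducedPath P u v m) → at π zero ≡ u
  at-zero (nil _)          = refl
  at-zero (cons _ _ _ _ _) = refl

  at-last : ∀ {m} (π : InducedPath P u v m) → at π (fromℕ m) ≡ v
  at-last (nil _)          = refl
  at-last (cons _ _ π _ _) = at-last π

  at-P : ∀ {m} (π : InducedPath P u v m) i → P (at π i)
  at-P (nil p)          _       = p
  at-P (cons p _ _ _ _) zero    = p
  at-P (cons _ _ π _ _) (suc i) = at-P π i

  at-injective : ∀ {m} (π : InducedPath P u v m) → Injective _≡_ _≡_ (at π)
  at-injective (nil _) {zero} {zero} _ = refl
  at-injective (cons _ _ _ _ _) {zero}  {zero}  _  = refl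
  at-injective (cons _ _ _ ≢u _) {zero}  {suc j} eq = contradiction (sym eq) (≢u j)
  at-injective (cons _ _ _ ≢u _) {suc i} {zero}  eq = contradiction eq (≢u i)
  at-injective (cons _ _ π _ _) {suc i} {suc j} eq = cong suc (at-injective π eq)

  at-edge : ∀ {m} (π : InducedPath P u v m) {i j} → Succ i j → Edge G (at π i) (at π j)
  at-edge (nil _) {zero} {zero} ()
  at-edge (cons _ e π _ _) zero    = subst (Edge G _) (sym (at-zero π)) e
  at-edge (cons _ _ π _ _) (suc s) = at-edge π s

  at-chord : ∀ {m} (π : InducedPath P u v m) i j → Edge G (at π i) (at π j) →
             Succ i j ⊎ Succ j i
  at-chord (nil _) _ _ e = contradiction refl (edge⇒≢ e)
  at-chord (cons _ _ _ _ _) zero zero e = contradiction refl (edge⇒≢ e)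
  at-chord (cons _ _ _ _ only) zero    (suc j) e with only j e
  at-chord {m = suc _} (cons _ _ _ _ _) zero (suc _) e | refl = inj₁ zero
  at-chord (cons _ _ _ _ only) (suc i) zero    e with only i (edge-sym e)
  at-chord {m = suc _} (cons _ _ _ _ _) (suc _) zero e | refl = inj₂ zero
  at-chord (cons _ _ π _ _) (suc i) (suc j) e with at-chord π i j e
  ... | inj₁ s = inj₁ (suc s)
  ... | inj₂ s = inj₂ (suc s)

  Apart : ∀ {m} → Fin n → InducedPath P u v m → Set
  Apart t π = ∀ i → at π i ≢ t × ¬ Edge G t (at π i)

  -- A vertex touching an induced path is joined to the suffix starting at the last vertex it touches.
  attach : ∀ {m} t → P t → (π : InducedPath P u v m) →
           Apart t π ⊎ ∃ (InducedPath P t v)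
  attach t pt (nil {u} p) with u ≟ t | edge? t u
  ... | yes refl | _     = inj₂ (_ , nil p)
  ... | no u≢t   | yes e = inj₂ (_ , cons pt e (nil p) (λ _ → u≢t) λ { zero _ → refl })
  ... | no u≢t   | no ¬e = inj₁ λ _ → u≢t , ¬e
  attach t pt π@(cons {u} _ _ π′ _ _) with attach t pt π′
  ... | inj₂ ρ = inj₂ ρ
  ... | inj₁ apart with u ≟ t | edge? t u
  ...   | yes refl | _     = inj₂ (_ , π)
  ...   | no u≢t   | yes e = inj₂ (_ , cons pt e π
            (λ { zero → u≢t ; (suc i) → proj₁ (apart i) })
            (λ { zero _ → refl ; (suc i) d → contradiction d (proj₂ (apart i)) }))
  ...   | no u≢t   | no ¬e = inj₁ λ { zero → u≢t , ¬e ; (suc i) → apart i }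

  reach⇒inducedPath : Reach G P u v → ∃ (InducedPath P u v)
  reach⇒inducedPath (here p) = _ , nil p
  reach⇒inducedPath (step {u} p e r) with reach⇒inducedPath r
  ... | _ , π with attach u p π
  ...   | inj₂ ρ     = ρ
  -- `u` is adjacent to the first vertex of `π`, so it cannot be apart from `π`.
  ...   | inj₁ apart =
          contradiction (subst (Edge G u) (sym (at-zero π)) e) (proj₂ (apart zero))

  -- Links and the chordless cycles they close.

  Spoke : Fin n → Fin n → Fin n → Set
  Spoke a x z = z ≢ a × (Edge G a z → z ≡ x)

  Linking : Fin n → Fin n → Fin n → Fin n → Set
  Linking a x y z = z ≢ a × (Edge G a z → z ≡ x ⊎ z ≡ y)

  Link : Fin n → Fin n → Fin n → Set
  Link a x y = Reach G (Linking a x y) x y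

  edge⇒link : ∀ {a x y} → x ≢ a → y ≢ a → Edge G x y → Link a x y
  edge⇒link x≢a y≢a e = step (x≢a , λ _ → inj₁ refl) e (here (y≢a , λ _ → inj₂ refl))

  module _ {a x y : Fin n} (ax : Edge G a x) (ay : Edge G a y) where

    -- A path with `suc m` edges has `m + 2` vertices, and `a` at index zero makes `m + 3`; hence
    -- `len` is `m`.
    close : ∀ {m} → InducedPath (Linking a x y) x y (suc m) → Cycle G
    close {m} π = record
      { len = m ; vert = vertex ; inj = injective ; edges = edge }
      where
      vertex : Fin (suc (suc (suc m))) → Fin n
      vertex zero    = a
      vertex (suc i) = at π i

      injective : Injective _≡_ _≡_ vertex
      injective {zero}  {zero}  _  = refl
      injective {zero}  {suc j} eq = contradiction (sym eq) (proj₁ (at-P π j))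
      injective {suc i} {zero}  eq = contradiction eq (proj₁ (at-P π i))
      injective {suc i} {suc j} eq = cong suc (at-injective π eq)

      edge : ∀ i → Edge G (vertex i) (vertex (next i))
      edge zero    = subst (Edge G a) (sym (at-zero π)) ax
      edge (suc i) with next-view i
      ... | inj₁ s    rewrite Succ⇒next (suc s) = at-edge π s
      -- The last index wraps around: its edge returns from `y` to `a`.
      ... | inj₂ refl rewrite next-last (suc (suc m)) | at-last π = edge-sym ay

    -- `Linking` leaves the two ends of the path as the only possible neighbours of `a`; all other
    -- chords are excluded because the path is induced.
    close-chordless : ∀ {m} (π : InducedPath (Linking a x y) x y (suc m)) →
                      Chordless (close π)
    close-chordless {m} π = chordless
      where
      spoke : ∀ j → Edge G a (at π j) → CycAdj zero (suc j)
      spoke j e with proj₂ (at-P π j) e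
      ... | inj₁ eq = inj₁ (cong suc (at-injective π (trans eq (sym (at-zero π)))))
      ... | inj₂ eq = inj₂ (sym (trans
              (cong (next ∘ suc) (at-injective π (trans eq (sym (at-last π)))))
              (next-last (suc (suc m)))))

      chordless : Chordless (close π)
      chordless zero    zero    e = contradiction refl (edge⇒≢ e)
      chordless zero    (suc j) e = spoke j e
      chordless (suc i) zero    e = swap (spoke i (edge-sym e))
      chordless (suc i) (suc j) e with at-chord π i j e
      ... | inj₁ s = inj₁ (sym (Succ⇒next (suc s)))
      ... | inj₂ s = inj₂ (sym (Succ⇒next (suc s)))

  -- Local constraints imposed by a cyclic orientation.

  module _ (O : Orientation G) (cyclic : IsCyclicOrientation O) where

    -- On the closed cycle the edge at index zero joins `a` to `x` and the edge at the last index
    -- joins `y` to `a`. Traversed consistently, one leaves `a` and the other enters it.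
    link⇒dir≢ : ∀ {a x y} → Edge G a x → Edge G a y → x ≢ y → Link a x y →
                dir O a x ≢ dir O a y
    link⇒dir≢ {a} {x} {y} ax ay x≢y r with reach⇒inducedPath r
    ... | zero  , nil _ = contradiction refl x≢y
    ... | suc m , π with cyclic (close ax ay π) (close-chordless ax ay π)
    ...   | inj₁ fwd = λ eq → Bool.not-¬ refl
            (trans (sym eq) (trans ax↦ (trans (sym ya↦) (oneway O a y ay))))
      where
      ax↦ : dir O a x ≡ true
      ax↦ = subst (λ t → dir O a t ≡ true) (at-zero π) (fwd zero)
      ya↦ : dir O y a ≡ true
      ya↦ = subst₂ (λ s t → dir O s t ≡ true) (at-last π)
              (cong (vert (close ax ay π)) (next-last (suc (suc m)))) (fwd (fromℕ (suc (suc m))))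
    ...   | inj₂ bwd = λ eq → Bool.not-¬ refl
            (trans eq (trans ay↦ (trans (sym xa↦) (oneway O a x ax))))
      where
      xa↦ : dir O x a ≡ true
      xa↦ = subst (λ t → dir O t a ≡ true) (at-zero π) (bwd zero)
      ay↦ : dir O a y ≡ true
      ay↦ = subst₂ (λ s t → dir O s t ≡ true)
              (cong (vert (close ax ay π)) (next-last (suc (suc m)))) (at-last π) (bwd (fromℕ (suc (suc m))))

    no-link-triangle : ∀ {a x y z} → Edge G a x → Edge G a y → Edge G a z →
      x ≢ y → y ≢ z → x ≢ z → Link a x y → Link a y z → Link a x z → ⊥
    no-link-triangle ax ay az x≢y y≢z x≢z xy yz xz =
      no-three-Bools (link⇒dir≢ ax ay x≢y xy) (link⇒dir≢ ay az y≢z yz) (link⇒dir≢ ax az x≢z xz)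

    -- Reversing one spoke and following another through the hub `b` links every pair among `x`,
    -- `y`, `z`.
    no-tripod : ∀ {a b x y z} → Edge G a x → Edge G a y → Edge G a z →
      x ≢ y → y ≢ z → x ≢ z →
      Reach G (Spoke a x) b x → Reach G (Spoke a y) b y → Reach G (Spoke a z) b z → ⊥
    no-tripod {a} {b} ax ay az x≢y y≢z x≢z bx by bz =
      no-link-triangle ax ay az x≢y y≢z x≢z (join bx by) (join by bz) (join bx bz)
      where
      join : ∀ {x y} → Reach G (Spoke a x) b x → Reach G (Spoke a y) b y → Link a x y
      join bx by = reach-trans (reach-sym (reach-map (map₂ (inj₁ ∘_)) bx))
                               (reach-map (map₂ (inj₂ ∘_)) by)

    -- Degree bound when no edge separates.

    module _ (connected : ∀ v w → Edge G v w → ConnectedOn G (Minus₂ v w)) where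

      -- Let `r` be the first vertex adjacent to `v` or `w` on a walk from `k` outside the triangle.
      -- If `r` is adjacent to both, then `c`, `w`, `r` are pairwise linked at `v`; otherwise there
      -- is a tripod at whichever of `v`, `w` is not adjacent to `r`.
      triangle-case : ∀ {c v w k} → Edge G c v → Edge G c w → Edge G c k → Edge G v w →
                      k ≢ v → k ≢ w → ⊥
      triangle-case {c} {v} {w} {k} cv cw ck vw k≢v k≢w =
        let p₁ , vp₁ , r₁ = contact v w cv cw (edge-sym vw) k≢v k≢w
            p₂ , wp₂ , r₂ = contact w v cw cv vw k≢w k≢v
            r₂′ = reach-map flip r₂
            r , touch , kr = reach-first (λ t → edge? v t ⊎-dec edge? w t) r₁ (inj₁ vp₁)
            outside , _ = reach-last kr
            kr₀ = reach-map proj₁ kr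
        -- Both contact walks are made to start at `r` by first returning to `k`.
        in  finish r touch kr outside
              (reach-trans (reach-sym kr₀) r₁) vp₁ (reach-trans (reach-sym kr₀) r₂′) wp₂
        where
        Outside : Fin n → Fin n → Fin n → Set
        Outside s t z = z ≢ c × z ≢ s × z ≢ t

        flip : ∀ {s t z} → Outside s t z → Outside t s z
        flip (a , b , d) = a , d , b

        -- Deleting the ends of the edge `c t` keeps `k` joined to `s`; the walk is cut just before
        -- `s`.
        contact : ∀ s t → Edge G c s → Edge G c t → Edge G t s → k ≢ s → k ≢ t →
                  ∃[ q ] (Edge G s q × Reach G (Outside s t) k q)
        contact s t cs ct ts k≢s k≢t
          with first-hit (_≟ s)
                 (connected c t ct k s (≢-sym (edge⇒≢ ck) , k≢t) (≢-sym (edge⇒≢ cs) , ≢-sym (edge⇒≢ ts)))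
                 k≢s refl
        ... | q , _ , kq , e , _ , refl =
              q , edge-sym e , reach-map (λ ((z≢c , z≢t) , z≢s) → z≢c , z≢s , z≢t) kq

        -- The tripod at t has its hub at r and ends at s, c and the first neighbour of t after r.
        side : ∀ s t r q → Edge G c s → Edge G c t → Edge G s t → Edge G s r → ¬ Edge G t r →
               Reach G (λ z → Outside s t z × (Edge G t z → z ≡ r)) k r →
               Reach G (Outside s t) r q → Edge G t q → ⊥
        side s t r q cs ct st sr ¬tr kr rq tq
          with reach-first (edge? t) rq tq
        ... | p , tp , rp =
              no-tripod (edge-sym st) (edge-sym ct) tp
                (≢-sym (edge⇒≢ cs)) (≢-sym p≢c) (≢-sym p≢s)
                (step (r≢t , λ d → contradiction d ¬tr) (edge-sym sr)
                  (here (edge⇒≢ st , λ _ → refl)))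
                (reach-snoc (reach-sym (reach-map (λ ((_ , _ , z≢t) , only) → z≢t ,
                    λ d → contradiction (subst (Edge G t) (only d) d) ¬tr) kr))
                  (edge-sym ck) (edge⇒≢ ct , λ _ → refl))
                (reach-map (λ ((_ , _ , z≢t) , only) → z≢t , only) rp)
          where
          r≢t = proj₂ (proj₂ (reach-head rq))
          p≢c = proj₁ (proj₁ (reach-last rp))
          p≢s = proj₁ (proj₂ (proj₁ (reach-last rp)))

        finish : ∀ r → Edge G v r ⊎ Edge G w r →
                 Reach G (λ z → Outside v w z × (Edge G v z ⊎ Edge G w z → z ≡ r)) k r →
                 Outside v w r →
                 ∀ {p₁ p₂} → Reach G (Outside v w) r p₁ → Edge G v p₁ →
                 Reach G (Outside v w) r p₂ → Edge G w p₂ → ⊥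
        finish r touch kr (r≢c , r≢v , r≢w) rp₁ vp₁ rp₂ wp₂ with edge? v r | edge? w r
        ... | yes vr | yes wr =
              no-link-triangle (edge-sym cv) vw vr (edge⇒≢ cw) (≢-sym r≢w) (≢-sym r≢c)
                (edge⇒link (edge⇒≢ cv) (≢-sym (edge⇒≢ vw)) cw)
                (edge⇒link (≢-sym (edge⇒≢ vw)) r≢v wr)
                (step (edge⇒≢ cv , λ _ → inj₁ refl) ck
                  (reach-map (λ ((_ , z≢v , _) , only) → z≢v , inj₂ ∘ only ∘ inj₁) kr))
        ... | yes vr | no ¬wr = side v w r _ cv cw vw vr ¬wr
                (reach-map (map₂ (_∘ inj₂)) kr) rp₂ wp₂
        ... | no ¬vr | yes wr = side w v r _ cw cv (edge-sym vw) wr ¬vr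
                (reach-map (λ (o , only) → flip o , only ∘ inj₁) kr) (reach-map flip rp₁) vp₁
        ... | no ¬vr | no ¬wr = [ ¬vr , ¬wr ]′ touch

      Far : Fin n → Fin n → Set
      Far c z = z ≢ c × ¬ Edge G c z

      -- No third neighbour of `c` touches `Interior`, so `k` reaches neighbours of both `v` and `w`
      -- outside it. Then `v` has three pairwise linked neighbours: `c`, one outside `Interior` and
      -- one inside.
      nonadjacent-case : ∀ {c v w k y i} → Edge G c v → Edge G c w → Edge G c k → ¬ Edge G v w →
        v ≢ w → k ≢ v → k ≢ w → Edge G w y → Reach G (Far c) y i → Edge G i v → ⊥
      nonadjacent-case {c} {v} {w} {k} {y} {i} cv cw ck ¬vw v≢w k≢v k≢w wy yi iv =
        let p₁ , vp₁ , kp₁ = contact v w cw (≢-sym (edge⇒≢ cv)) v≢w k≢v k≢w only-vw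
            p₂ , wp₂ , kp₂ = contact w v cv (≢-sym (edge⇒≢ cw)) (≢-sym v≢w) k≢w k≢v
                                (λ p a b → only-vw p b a)
            -- From `p₂` back to `k` and on towards `p₁`, stopping at the first neighbour of `v`.
            p , vp , p₂p = reach-first (edge? v)
              (reach-trans (reach-sym (reach-map (λ (a , b , d , e) → a , d , b , e) kp₂)) kp₁) vp₁
            j , vj , yj = reach-first (edge? v) yi (edge-sym iv)
            p≢c , _ , _ , p∉ = proj₁ (reach-last p₂p)
            far-j = proj₁ (reach-last yj)
        in  -- The hub is w; its walks go directly to c, through k to p, and through Interior to j.
            no-tripod (edge-sym cv) vp vj
              (≢-sym p≢c)
              (λ p≡j → p∉ (subst Interior (sym p≡j) (reach-map proj₁ yj)))
              (≢-sym (proj₁ far-j))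
              (step at-w (edge-sym cw) (here (edge⇒≢ cv , λ _ → refl)))
              (step at-w wp₂ (reach-map (λ ((_ , z≢v , _) , only) → z≢v , only) p₂p))
              (step at-w wy (reach-map (λ (far , only) → far⇒≢ cv far , only) yj))
        where
        Interior : Fin n → Set
        Interior = Reach G (Far c) y

        far? : Decidable (Far c)
        far? z = ¬? (z ≟ c) ×-dec ¬? (edge? c z)

        interior? : Decidable Interior
        interior? = reach? far? y

        far⇒≢ : ∀ {s z} → Edge G c s → Far c z → z ≢ s
        far⇒≢ cs (_ , ¬cz) refl = ¬cz cs

        at-w : ∀ {x} → Spoke v x w
        at-w = ≢-sym v≢w , λ d → contradiction d ¬vw

        spoke : ∀ {b x z} → Edge G c z → Reach G (Far c) b x → Edge G x z → Reach G (Spoke c z) b z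
        spoke cz bx xz = reach-snoc (reach-map (map₂ λ ¬e e → contradiction e ¬e) bx) xz
                           (≢-sym (edge⇒≢ cz) , λ _ → refl)

        -- Otherwise `b` is the hub of a tripod at `c`: it reaches `v` and `w` through `Interior`
        -- and `p` by an edge.
        only-vw : ∀ {p b} → Edge G c p → p ≢ v → p ≢ w → Edge G p b → ¬ Interior b
        only-vw cp p≢v p≢w pb yb =
          no-tripod cv cw cp v≢w (≢-sym p≢w) (≢-sym p≢v)
            (spoke cv (reach-trans (reach-sym yb) yi) iv)
            (spoke cw (reach-sym yb) (edge-sym wy))
            (spoke cp (here (reach-last yb)) (edge-sym pb))

        contact : ∀ s t → Edge G c t → s ≢ c → s ≢ t → k ≢ s → k ≢ t →
          (∀ {p b} → Edge G c p → p ≢ s → p ≢ t → Edge G p b → ¬ Interior b) →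
          ∃[ q ] (Edge G s q × Reach G (λ z → z ≢ c × z ≢ s × z ≢ t × ¬ Interior z) k q)
        contact s t ct s≢c s≢t k≢s k≢t only-st
          with first-hit (λ z → (z ≟ s) ⊎-dec interior? z)
                 (connected c t ct k s (≢-sym (edge⇒≢ ck) , k≢t) (s≢c , s≢t))
                 [ k≢s , (λ yk → proj₂ (reach-last yk) ck) ]′ (inj₁ refl)
        ... | q , _ , kq , e , _ , inj₁ refl = q , edge-sym e ,
              reach-map (λ ((z≢c , z≢t) , ¬hit) → z≢c , ¬hit ∘ inj₁ , z≢t , ¬hit ∘ inj₂) kq
        -- Entry into `Interior` is impossible: the preceding vertex `q` is either a neighbour of
        -- `c`, excluded by `only-st`, or far from `c` and so already in `Interior`.
        ... | q , z , kq , e , _ , inj₂ yz with reach-last kq | edge? c q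
        ...   | (q≢c , q≢t) , ¬hit | yes cq = contradiction yz (only-st cq (¬hit ∘ inj₁) q≢t e)
        ...   | (q≢c , q≢t) , ¬hit | no ¬cq =
                contradiction (inj₂ (reach-snoc yz (edge-sym e) (q≢c , ¬cq))) ¬hit

      -- With `c` and `k` deleted, `v` still reaches `x`. Stopping at the first neighbour `w` of `c`
      -- other than `v` gives a link from `v` to `w` that misses `k`.
      degree≤2 : ∀ {c u v w} → Edge G c u → Edge G c v → Edge G c w →
                 u ≢ v → v ≢ w → u ≢ w → ⊥
      degree≤2 {c} {k} {v} {x} ck cv cx k≢v v≢x k≢x
        with first-hit (λ z → edge? c z ×-dec ¬? (z ≟ v))
               (connected c k ck v x (≢-sym (edge⇒≢ cv) , ≢-sym k≢v) (≢-sym (edge⇒≢ cx) , ≢-sym k≢x))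
               (λ (_ , v≢v) → v≢v refl) (cx , ≢-sym v≢x)
      ... | y , w , vy , yw , (_ , w≢k) , cw , w≢v with edge? v w
      ...   | yes vw = triangle-case cv cw ck vw k≢v (≢-sym w≢k)
      ...   | no ¬vw
              -- Read backwards from `y` and cut before its first visit to `v`, the walk has no
              -- neighbour of `c` left.
              with first-hit (_≟ v) (reach-sym vy) (λ { refl → ¬vw yw }) refl
      ...     | i , _ , yi , iv , _ , refl =
                nonadjacent-case cv cw ck ¬vw (≢-sym w≢v) k≢v (≢-sym w≢k) (edge-sym yw)
                  (reach-map (λ (((z≢c , _) , ¬hit) , z≢v) → z≢c , λ cz → ¬hit (cz , z≢v)) yi) iv

  -- Recognising a cycle graph.

  -- The two cycle neighbours of a cycle vertex are all its neighbours, so `C` has no chord and no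
  -- walk leaves it; by connectedness it covers every vertex.
  degree≤2⇒cycle : Connected G → Cycle G →
    (∀ {c u v w} → Edge G c u → Edge G c v → Edge G c w → u ≢ v → v ≢ w → u ≢ w → ⊥) →
    IsCycleGraph G
  degree≤2⇒cycle connected C degree≤2 =
    -- Injections in both directions equate `n` with the number of vertices of `C`.
    cycleGraph (≤-antisym (injective⇒≤ section-injective) (injective⇒≤ (inj C)))
               (vert C) (inj C) (λ i j → mk⇔ (neighbour i j) λ { (inj₁ refl) → edges C i ; (inj₂ refl) → edge-sym (edges C j) })
    where
    neighbours : ∀ i {z} → Edge G (vert C i) z → ∃[ j ] (vert C j ≡ z × CycAdj i j)
    neighbours i {z} e with next-surjective i
    ... | p , refl with vert C (next (next p)) ≟ z | vert C p ≟ z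
    ...   | yes eq | _      = _ , eq , inj₁ refl
    ...   | no _   | yes eq = _ , eq , inj₂ refl
    ...   | no ≢₁  | no ≢₂  = ⊥-elim (degree≤2 (edges C (next p)) (edge-sym (edges C p)) e
              (next²≢id p ∘ inj C) ≢₂ ≢₁)

    neighbour : Chordless C
    neighbour i j e with neighbours i e
    ... | _ , eq , ij = subst (CycAdj i) (inj C eq) ij

    covered : ∀ {u v} → Reach G (λ _ → ⊤) u v → ∃[ i ] vert C i ≡ u → ∃[ i ] vert C i ≡ v
    covered (here _)     on        = on
    covered (step _ e r) (i , refl) = let j , eq , _ = neighbours i e in covered r (j , eq)

    section : ∀ z → ∃[ i ] vert C i ≡ z
    section z = covered (connected (vert C zero) z tt tt) (zero , refl)

    section-injective : Injective _≡_ _≡_ (proj₁ ∘ section)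
    section-injective {x} {y} eq =
      trans (sym (proj₂ (section x))) (trans (cong (vert C) eq) (proj₂ (section y)))

    -- Stated for arbitrary `m` and `f`, since `C` itself depends on `n`; matching the equation then
    -- lets `IsCycleGraph` reduce.
    cycleGraph : ∀ {m} → n ≡ suc (suc (suc m)) → (f : Fin (suc (suc (suc m))) → Fin n) →
      Injective _≡_ _≡_ f → (∀ i j → Edge G (f i) (f j) ⇔ CycAdj i j) → IsCycleGraph G
    cycleGraph refl f f-inj f-adj = s≤s (s≤s (s≤s z≤n)) , f , f-inj , f-adj

-- Existence of a separating edge by finite search.

theorem2 : ∀ {n} (G : Graph n) → TwoConnected G → CyclicallyOrientable G →
    ¬ IsCycleGraph G → ¬ IsSingleEdge G →
    ∃[ v ] ∃[ w ] (Edge G v w × DisconnectedMinus₂ G v w)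
theorem2 G (conn , (a , b , ab) , oncycle) (O , cyclic) ¬cycle _ =
  decidable-stable
    (any? λ v → any? λ w → edge? {G = G} v w ×-dec ¬? (minus₂? v w))
    -- The initial cycle comes from two-connectedness applied to the edge `a b` twice.
    λ none → ¬cycle (degree≤2⇒cycle conn (proj₁ (oncycle a b a b ab ab))
      (degree≤2 O cyclic λ v w vw →
        decidable-stable (minus₂? v w) λ disc → none (v , w , vw , disc)))
  where
  minus₂? : ∀ v w → Dec (ConnectedOn G (Minus₂ v w))
  minus₂? v w = connectedOn? λ z → ¬? (z ≟ v) ×-dec ¬? (z ≟ w)
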